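{- For every formula $\varphi\in\mathcal L$: $\models_{\mathsf{InqI}}\varphi$ if and only if $\models_{\mathsf{S4}\text{ - }\mathsf{MT}_0}\varphi^\Box$, where the translation $(\cdot)^\Box:\mathcal L\to\mathcal L_d$ is defined inductively by $p^\Box=\Box p$, $\bot^\Box=\Box\bot$, $(\varphi\land\psi)^\Box=\varphi^\Box\land\psi^\Box$, $(\varphi\lor\psi)^\Box=\varphi^\Box\lor\psi^\Box$, $(\varphi\sqcup\psi)^\Box=\varphi^\Box\sqcup\psi^\Box$, and $(\varphi\to\psi)^\Box=\Box(\varphi^\Box\to\psi^\Box)$.
   Context: Fix a set $\mathcal P$ of atomic sentences. The language $\mathcal L$ is given by $\varphi::=p\mid\bot\mid\varphi\land\varphi\mid\varphi\lor\varphi\mid\varphi\to\varphi\mid\varphi\sqcup\varphi$ with $p\in\mathcal P$, where $\lor$ is standard disjunction and $\sqcup$ denotes inquisitive disjunction. Logic $\mathsf{InqI}$. An intuitionistic Kripke model is $M=\langle W,R,V\rangle$ with $W$ a set (of worlds), $R$ a partial order on $W$, and $V:W\times\mathcal P\to\{0,1\}$ such that $wRw'$ and $V(w,p)=1$ imply $V(w',p)=1$. A team is a set $t\subseteq W$; $R[w]=\{w'\mid wRw'\}$ and $R[t]=\bigcup_{w\in t}R[w]$. Support $M,t\models\varphi$ is defined by: - $M,t\models p$ iff $V(w,p)=1$ for all $w\in t$; - $M,t\models\bot$ iff $t=\emptyset$; - $M,t\models\varphi\land\psi$ iff $M,t\models\varphi$ and $M,t\models\psi$; - $M,t\models\varphi\lor\psi$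 iff there are $t',t''$ with $t=t'\cup t''$, $M,t'\models\varphi$ and $M,t''\models\psi$; - $M,t\models\varphi\to\psi$ iff for all $t'\subseteq R[t]$, $M,t'\models\varphi$ implies $M,t'\models\psi$; - $M,t\models\varphi\sqcup\psi$ iff $M,t\models\varphi$ or $M,t\models\psi$. $\models_{\mathsf{InqI}}\varphi$ means $M,t\models\varphi$ for all intuitionistic Kripke models $M$ and teams $t$. Logic $\mathsf{S4}\text{ - }\mathsf{MT}_0$. The language $\mathcal L_d$ is given by $\varphi::=p\mid\bot\mid{=}(p_1,\dots,p_n,q)\mid\varphi\land\varphi\mid\varphi\lor\varphi\mid\varphi\to\varphi\mid\varphi\sqcup\varphi\mid\Box\varphi\mid\Diamond\varphi$. A modal Kripke model is $M=\langle W,R,V\rangle$ with $W$ a set, $R$ a binary relation on $W$ and $V:W\times\mathcal P\to\{0,1\}$ any function; it is an $\mathsf{S4}$-modal Kripke model if $R$ is reflexive and transitive. Teams are sets $t\subseteq W$, with $R[w]=\{w'\mid wRw'\}$ and $R[t]=\bigcup_{w\in t}R[w]$; for teams $t,t'$, write $tRt'$ iff $t'\subseteq R[t]$ and $R[w]\cap t'\neq\emptyset$ for all $w\in t$. Satisfaction $M,t\models\varphi$ for $\varphi\in\mathcal L_d$ is defined by: - $M,t\models p$ iff $V(w,p)=1$ for all $w\in t$; - $M,t\models\bot$ iff $t=\emptyset$; - $M,t\models\varphi\land\psi$ iff $M,t\models\varphi$ and $M,t\models\psi$; - $M,t\models\varphi\lor\psi$ iff there are $t',t''$ with $t=t'\cup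 t''$, $M,t'\models\varphi$ and $M,t''\models\psi$; - $M,t\models\varphi\sqcup\psi$ iff $M,t\models\varphi$ or $M,t\models\psi$; - $M,t\models{=}(p_1,\dots,p_n,q)$ iff for all $w,w'\in t$, if $V(w,p_i)=V(w',p_i)$ for all $1\le i\le n$ then $V(w,q)=V(w',q)$; - $M,t\models\varphi\to\psi$ iff for all $t'\subseteq t$, $M,t'\models\varphi$ implies $M,t'\models\psi$; - $M,t\models\Diamond\varphi$ iff there is $t'$ with $tRt'$ and $M,t'\models\varphi$; - $M,t\models\Box\varphi$ iff for all $t'$, $tRt'$ implies $M,t'\models\varphi$. $\models_{\mathsf{S4}\text{ - }\mathsf{MT}_0}\varphi$ means $M,t\models\varphi$ for all $\mathsf{S4}$-modal Kripke models $M$ and teams $t$. -}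

module Defs where

open import Data.Bool using (Bool; true)
open import Data.Product using (_×_; ∃-syntax)
open import Data.Sum using (_⊎_)
open import Data.Vec using (Vec; lookup)
open import Level using (Level; Lift; suc) renaming (_⊔_ to _⊔ℓ_)
open import Relation.Binary using (Rel; IsPartialOrder; Reflexive; Transitive)
open import Relation.Binary.PropositionalEquality using (_≡_)
open import Relation.Unary using (Pred; _∈_; _⊆_; _∪_; _∩_; _≐_; Empty; Satisfiable)

infixr 7 _∧_
infixr 6 _∨_ _⊔_
infixr 5 _⇒_
infix  8 □_ ◇_

-- _∨_ is standard (splitting) disjunction, _⊔_ is inquisitive disjunction.
data Formula {a} (P : Set a) : Set a where
  atom        : P → Formula P
  ⊥           : Formula P
  _∧_ _∨_ _⇒_ _⊔_ : Formula P → Formula P → Formula P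

data FormulaD {a} (P : Set a) : Set a where
  atom        : P → FormulaD P
  ⊥           : FormulaD P
  dep         : ∀ {n} → Vec P n → P → FormulaD P
  _∧_ _∨_ _⇒_ _⊔_ : FormulaD P → FormulaD P → FormulaD P
  □_ ◇_       : FormulaD P → FormulaD P

_^□ : ∀ {a} {P : Set a} → Formula P → FormulaD P
atom p  ^□ = □ atom p
⊥       ^□ = □ ⊥
(φ ∧ ψ) ^□ = (φ ^□) ∧ (ψ ^□)
(φ ∨ ψ) ^□ = (φ ^□) ∨ (ψ ^□)
(φ ⊔ ψ) ^□ = (φ ^□) ⊔ (ψ ^□)
(φ ⇒ ψ) ^□ = □ ((φ ^□) ⇒ (ψ ^□))

-- Sets of worlds are predicates.  Worlds, accessibility and teams share one
-- level ℓ, so that teams are closed under R[ w ] and R[[ t ]].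
Team : ∀ {ℓ} → Set ℓ → Set (suc ℓ)
Team {ℓ} W = Pred W ℓ

module Accessibility {ℓ} {W : Set ℓ} (R : Rel W ℓ) where

  R[_] : W → Team W
  R[ w ] w′ = R w w′

  R[[_]] : Team W → Team W
  R[[ t ]] w′ = ∃[ w ] (w ∈ t × w′ ∈ R[ w ])

  _R→_ : Team W → Team W → Set ℓ
  t R→ t′ = t′ ⊆ R[[ t ]] × (∀ w → w ∈ t → Satisfiable (R[ w ] ∩ t′))

record IntModel {a} (P : Set a) (ℓ : Level) : Set (a ⊔ℓ suc ℓ) where
  field
    W              : Set ℓ
    R              : Rel W ℓ
    isPartialOrder : IsPartialOrder _≡_ R
    V              : W → P → Bool
    persistent     : ∀ {w w′ p} → R w w′ → V w p ≡ true → V w′ p ≡ true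
  open Accessibility R public

record ModalModel {a} (P : Set a) (ℓ : Level) : Set (a ⊔ℓ suc ℓ) where
  field
    W : Set ℓ
    R : Rel W ℓ
    V : W → P → Bool
  open Accessibility R public

record IsS4 {a} {P : Set a} {ℓ} (M : ModalModel P ℓ) : Set ℓ where
  open ModalModel M
  field
    reflexive  : Reflexive R
    transitive : Transitive R

-- Lift only adjusts universe levels: clauses quantifying over teams live in
-- Set (suc ℓ).
module _ {a} {P : Set a} {ℓ} (M : IntModel P ℓ) where
  open IntModel M

  Support : Team W → Formula P → Set (suc ℓ)
  Support t (atom p) = Lift (suc ℓ) (∀ w → w ∈ t → V w p ≡ true)
  Support t ⊥        = Lift (suc ℓ) (Empty t)
  Support t (φ ∧ ψ)  = Support t φ × Support t ψ
  Support t (φ ∨ ψ)  = ∃[ t′ ] ∃[ t″ ] (t ≐ t′ ∪ t″ × Support t′ φ × Support t″ ψ)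
  Support t (φ ⇒ ψ)  = ∀ (t′ : Team W) → t′ ⊆ R[[ t ]] → Support t′ φ → Support t′ ψ
  Support t (φ ⊔ ψ)  = Support t φ ⊎ Support t ψ

module _ {a} {P : Set a} {ℓ} (M : ModalModel P ℓ) where
  open ModalModel M

  Satisfies : Team W → FormulaD P → Set (suc ℓ)
  Satisfies t (atom p) = Lift (suc ℓ) (∀ w → w ∈ t → V w p ≡ true)
  Satisfies t ⊥        = Lift (suc ℓ) (Empty t)
  Satisfies t (dep ps q) = Lift (suc ℓ)
    (∀ w w′ → w ∈ t → w′ ∈ t →
      (∀ i → V w (lookup ps i) ≡ V w′ (lookup ps i)) → V w q ≡ V w′ q)
  Satisfies t (φ ∧ ψ)  = Satisfies t φ × Satisfies t ψ
  Satisfies t (φ ∨ ψ)  = ∃[ t′ ] ∃[ t″ ] (t ≐ t′ ∪ t″ × Satisfies t′ φ × Satisfies t″ ψ)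
  Satisfies t (φ ⇒ ψ)  = ∀ (t′ : Team W) → t′ ⊆ t → Satisfies t′ φ → Satisfies t′ ψ
  Satisfies t (φ ⊔ ψ)  = Satisfies t φ ⊎ Satisfies t ψ
  Satisfies t (□ φ)    = ∀ (t′ : Team W) → t R→ t′ → Satisfies t′ φ
  Satisfies t (◇ φ)    = ∃[ t′ ] (t R→ t′ × Satisfies t′ φ)

ValidInqI : ∀ {a} {P : Set a} (ℓ : Level) → Formula P → Set (a ⊔ℓ suc ℓ)
ValidInqI {P = P} ℓ φ = (M : IntModel P ℓ) (t : Team (IntModel.W M)) → Support M t φ

ValidS4MT₀ : ∀ {a} {P : Set a} (ℓ : Level) → FormulaD P → Set (a ⊔ℓ suc ℓ)
ValidS4MT₀ {P = P} ℓ φ =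
  (M : ModalModel P ℓ) → IsS4 M → (t : Team (ModalModel.W M)) → Satisfies M t φ

{-# OPTIONS --safe #-}

-- Support of φ in an intuitionistic model N agrees with satisfaction of φ^□ in
-- an S4-model M along any p-morphism f : N → M under which p holds at u exactly
-- when □ p holds at f u; teams are transported by taking images.  The identity
-- of an intuitionistic model is such a map.  Conversely, every S4-model is the
-- image of a partial order: quotienting by mutual accessibility is replaced by
-- unfolding W to W × ℕ, where each proper step strictly increases the counter.
module Submission where

open import Defs
open import Axiom.ExcludedMiddle using (ExcludedMiddle)
open import Data.Bool using (true)
open import Data.Nat using (ℕ; _<_)
open import Data.Nat.Properties using (<-trans; <-asym; n<1+n)
open import Data.Product using (_×_; _,_; proj₁; proj₂; ∃-syntax)
open import Data.Sum using (_⊎_; inj₁; inj₂) renaming (map to map⊎)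
open import Function using (id; _∘_)
open import Function.Bundles using (_⇔_; mk⇔; Equivalence)
open import Level using (lift; lower) renaming (_⊔_ to _⊔ℓ_)
open import Relation.Binary
  using (Rel; IsPartialOrder; Reflexive; Transitive; Antisymmetric)
open import Relation.Binary.PropositionalEquality
  using (_≡_; refl; isEquivalence)
open import Relation.Nullary using (Dec; yes; does; contradiction)
open import Relation.Nullary.Decidable using (dec-true)
open import Relation.Unary using (_∈_; _⊆_; _∪_; _∩_; _≐_)

image : ∀ {ℓ} {A B : Set ℓ} → (A → B) → Team A → Team B
image f t b = ∃[ a ] (a ∈ t × f a ≡ b)

image-id : ∀ {ℓ} {A : Set ℓ} (t : Team A) → t ≐ image id t
image-id t = (λ x∈t → _ , x∈t , refl) , λ { (_ , x∈t , refl) → x∈t }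

image-∪ : ∀ {ℓ} {A B : Set ℓ} (f : A → B) {t t₁ t₂ : Team A} {s : Team B} →
  s ≐ image f t → t ≐ t₁ ∪ t₂ → s ≐ image f t₁ ∪ image f t₂
image-∪ f {t} {t₁} {t₂} {s} (s⊆ , ⊆s) (t⊆ , ⊆t) = to , from
  where
  to : s ⊆ image f t₁ ∪ image f t₂
  to b∈s with s⊆ b∈s
  ... | a , a∈t , eq = map⊎ (λ a∈t₁ → a , a∈t₁ , eq) (λ a∈t₂ → a , a∈t₂ , eq) (t⊆ a∈t)
  from : image f t₁ ∪ image f t₂ ⊆ s
  from (inj₁ (a , a∈t₁ , eq)) = ⊆s (a , ⊆t (inj₁ a∈t₁) , eq)
  from (inj₂ (a , a∈t₂ , eq)) = ⊆s (a , ⊆t (inj₂ a∈t₂) , eq)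

-- Cutting the preimage down to `t` loses nothing of `s`, as each point of `s` already has a
-- preimage in `t`. The cases of `∨` and `⇒` use this to carry teams backwards along `f`.
image-∩-preimage : ∀ {ℓ} {A B : Set ℓ} (f : A → B) {t : Team A} {s : Team B} →
  s ⊆ image f t → s ≐ image f (t ∩ (s ∘ f))
image-∩-preimage f {t} {s} s⊆ = to , λ { (_ , (_ , fa∈s) , refl) → fa∈s }
  where
  to : s ⊆ image f (t ∩ (s ∘ f))
  to b∈s with s⊆ b∈s
  ... | a , a∈t , refl = a , (a∈t , b∈s) , refl

module _ {ℓ} {W : Set ℓ} {R : Rel W ℓ} (reflexive : Reflexive R) where
  open Accessibility R

  -- `R[[ t ]]` is the largest team that `t` can reach by `R→`, and reflexivity provides the
  -- successor each world of `t` must have in it. Every box below is opened at this team.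
  R→-successors : (t : Team W) → t R→ R[[ t ]]
  R→-successors t = id , λ w w∈t → w , reflexive , w , w∈t , reflexive

record IsBoxMorphism {a ℓ} {P : Set a} (N : IntModel P ℓ) (M : ModalModel P ℓ)
    (f : IntModel.W N → ModalModel.W M) : Set (a ⊔ℓ ℓ) where
  private
    module N = IntModel N
    module M = ModalModel M
  field
    forth : ∀ {u v} → N.R u v → M.R (f u) (f v)
    back  : ∀ {u w} → M.R (f u) w → ∃[ v ] (N.R u v × f v ≡ w)
    atoms : ∀ {u p} → N.V u p ≡ true ⇔ (∀ w → M.R (f u) w → M.V w p ≡ true)

module _ {a ℓ} {P : Set a} {N : IntModel P ℓ} {M : ModalModel P ℓ} (S4 : IsS4 M)
    {f : IntModel.W N → ModalModel.W M} (isBox : IsBoxMorphism N M f) where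
  private
    module N = IntModel N
    module M = ModalModel M
  open IsS4 S4
  open IsBoxMorphism isBox

  -- `back` gives one inclusion and `forth` the other. This matches the teams over which `⇒` ranges
  -- on the two sides.
  image-successors : ∀ {t s} → s ≐ image f t → M.R[[ s ]] ≐ image f N.R[[ t ]]
  image-successors {t} {s} (s⊆ , ⊆s) = to , from
    where
    to : M.R[[ s ]] ⊆ image f N.R[[ t ]]
    to (_ , w∈s , wRw′) with s⊆ w∈s
    ... | u , u∈t , refl with back wRw′
    ... | v , uRv , refl = v , (u , u∈t , uRv) , refl
    from : image f N.R[[ t ]] ⊆ M.R[[ s ]]
    from (_ , (u , u∈t , uRv) , refl) = f u , ⊆s (u , u∈t , refl) , forth uRv

  -- The two directions are mutually recursive because `⇒` is contravariant in its antecedent. The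
  -- team `s` is fixed only up to `≐`, since pulled-back teams have the right image just
  -- extensionally.
  support⇒satisfies : ∀ φ {t s} → s ≐ image f t →
    Support N t φ → Satisfies M s (φ ^□)
  satisfies⇒support : ∀ φ {t s} → s ≐ image f t →
    Satisfies M s (φ ^□) → Support N t φ

  support⇒satisfies (atom p) {t} (s⊆ , _) (lift h) s′ (s′⊆ , _) = lift at
    where
    at : ∀ w → w ∈ s′ → M.V w p ≡ true
    at w w∈s′ with s′⊆ w∈s′
    ... | _ , v∈s , vRw with s⊆ v∈s
    ... | u , u∈t , refl = Equivalence.to atoms (h u u∈t) w vRw
  support⇒satisfies ⊥ {t} (s⊆ , _) (lift h) s′ (s′⊆ , _) = lift λ w w∈s′ →
    let (_ , v∈s , _) = s′⊆ w∈s′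
        (u , u∈t , _) = s⊆ v∈s
    in h u u∈t
  support⇒satisfies (φ ∧ ψ) eq (h , k) =
    support⇒satisfies φ eq h , support⇒satisfies ψ eq k
  support⇒satisfies (φ ∨ ψ) eq (t₁ , t₂ , t≐ , h , k) =
    image f t₁ , image f t₂ , image-∪ f eq t≐ ,
    support⇒satisfies φ (id , id) h , support⇒satisfies ψ (id , id) k
  support⇒satisfies (φ ⊔ ψ) eq = map⊎ (support⇒satisfies φ eq) (support⇒satisfies ψ eq)
  -- `s″` lies among the successors of `s`, hence in the image of those of `t`; its pullback is thus
  -- a team to which `h` applies.
  support⇒satisfies (φ ⇒ ψ) {t} eq h s′ (s′⊆ , _) s″ s″⊆ k =
    support⇒satisfies ψ lifted
      (h (N.R[[ t ]] ∩ (s″ ∘ f)) proj₁ (satisfies⇒support φ lifted k))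
    where
    lifted : s″ ≐ image f (N.R[[ t ]] ∩ (s″ ∘ f))
    lifted = image-∩-preimage f λ w∈s″ → proj₁ (image-successors eq) (s′⊆ (s″⊆ w∈s″))

  satisfies⇒support (atom p) {t} {s} (_ , ⊆s) h = lift λ u u∈t →
    Equivalence.from atoms λ w uRw →
      lower (h M.R[[ s ]] (R→-successors reflexive s)) w (f u , ⊆s (u , u∈t , refl) , uRw)
  satisfies⇒support ⊥ {t} {s} (_ , ⊆s) h = lift λ u u∈t →
    lower (h M.R[[ s ]] (R→-successors reflexive s)) (f u)
      (f u , ⊆s (u , u∈t , refl) , reflexive)
  satisfies⇒support (φ ∧ ψ) eq (h , k) =
    satisfies⇒support φ eq h , satisfies⇒support ψ eq k
  -- The splitting of `s` is pulled back: each `u` in `t` has `f u` in `s`, hence in `s₁` or `s₂`.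
  satisfies⇒support (φ ∨ ψ) {t} (s⊆ , ⊆s) (s₁ , s₂ , (s⊆∪ , ∪⊆s) , h , k) =
    t ∩ (s₁ ∘ f) , t ∩ (s₂ ∘ f) , (to , from) ,
    satisfies⇒support φ (image-∩-preimage f λ w∈s₁ → s⊆ (∪⊆s (inj₁ w∈s₁))) h ,
    satisfies⇒support ψ (image-∩-preimage f λ w∈s₂ → s⊆ (∪⊆s (inj₂ w∈s₂))) k
    where
    to : t ⊆ (t ∩ (s₁ ∘ f)) ∪ (t ∩ (s₂ ∘ f))
    to u∈t = map⊎ (u∈t ,_) (u∈t ,_) (s⊆∪ (⊆s (_ , u∈t , refl)))
    from : (t ∩ (s₁ ∘ f)) ∪ (t ∩ (s₂ ∘ f)) ⊆ t
    from (inj₁ (u∈t , _)) = u∈t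
    from (inj₂ (u∈t , _)) = u∈t
  satisfies⇒support (φ ⊔ ψ) eq = map⊎ (satisfies⇒support φ eq) (satisfies⇒support ψ eq)
  -- Opening the box at all successors of `s` leaves room for the image of any `t′` among the
  -- successors of `t`.
  satisfies⇒support (φ ⇒ ψ) {t} {s} eq h t′ t′⊆ k =
    satisfies⇒support ψ (id , id)
      (h M.R[[ s ]] (R→-successors reflexive s) (image f t′) sub
        (support⇒satisfies φ (id , id) k))
    where
    sub : image f t′ ⊆ M.R[[ s ]]
    sub (u , u∈t′ , eq′) = proj₂ (image-successors eq) (u , t′⊆ u∈t′ , eq′)

module _ {a ℓ} {P : Set a} (N : IntModel P ℓ) where
  open IntModel N

  toModal : ModalModel P ℓ
  toModal = record { W = W ; R = R ; V = V }

  toModal-isS4 : IsS4 toModal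
  toModal-isS4 = record
    { reflexive  = IsPartialOrder.refl isPartialOrder
    ; transitive = IsPartialOrder.trans isPartialOrder
    }

  toModal-isBoxMorphism : IsBoxMorphism N toModal id
  toModal-isBoxMorphism = record
    { forth = id
    ; back  = λ uRw → _ , uRw , refl
    -- Persistence spreads `p` to all successors; reflexivity brings it back.
    ; atoms = mk⇔ (λ Vu w uRw → persistent uRw Vu)
                  (λ h → h _ (IsPartialOrder.refl isPartialOrder))
    }

module _ {ℓ} {W : Set ℓ} (R : Rel W ℓ) where

  Unfold : Rel (W × ℕ) ℓ
  Unfold (w , m) (w′ , n) = (w , m) ≡ (w′ , n) ⊎ (m < n × R w w′)

  Unfold-transitive : Transitive R → Transitive Unfold
  Unfold-transitive tr (inj₁ refl)        q                   = q
  Unfold-transitive tr p@(inj₂ _)         (inj₁ refl)         = p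
  Unfold-transitive tr (inj₂ (m<n , wRv)) (inj₂ (n<k , vRx)) =
    inj₂ (<-trans m<n n<k , tr wRv vRx)

  -- Opposite proper steps would need both `m < n` and `n < m`, so clusters of mutually accessible
  -- worlds unwind into ascending chains.
  Unfold-antisymmetric : Antisymmetric _≡_ Unfold
  Unfold-antisymmetric (inj₁ eq)        _                = eq
  Unfold-antisymmetric (inj₂ _)         (inj₁ refl)      = refl
  Unfold-antisymmetric (inj₂ (m<n , _)) (inj₂ (n<m , _)) = contradiction n<m (<-asym m<n)

  Unfold-isPartialOrder : Transitive R → IsPartialOrder _≡_ Unfold
  Unfold-isPartialOrder tr = record
    { isPreorder = record
      { isEquivalence = isEquivalence
      ; reflexive     = inj₁
      ; trans         = Unfold-transitive tr
      }
    ; antisym = Unfold-antisymmetric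
    }

  Unfold-forth : Reflexive R → ∀ {u v} → Unfold u v → R (proj₁ u) (proj₁ v)
  Unfold-forth rf (inj₁ refl)    = rf
  Unfold-forth rf (inj₂ (_ , r)) = r

does-true⇔ : ∀ {ℓ} {A : Set ℓ} (d : Dec A) → does d ≡ true ⇔ A
does-true⇔ d = mk⇔ (from d) (dec-true d)
  where
  from : ∀ {ℓ} {A : Set ℓ} (d : Dec A) → does d ≡ true → A
  from (yes x) _ = x

module _ {a ℓ} {P : Set a} (em : ExcludedMiddle ℓ) (M : ModalModel P ℓ) (S4 : IsS4 M) where
  open ModalModel M
  open IsS4 S4

  BoxAtom : P → W → Set ℓ
  BoxAtom p w = ∀ w′ → R w w′ → V w′ p ≡ true

  unfoldedModel : IntModel P ℓ
  unfoldedModel = record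
    { W              = W × ℕ
    ; R              = Unfold R
    ; isPartialOrder = Unfold-isPartialOrder R transitive
    -- Valuations are Boolean, so the truth of `□ p` at `w` must be decided: excluded middle enters
    -- here. Persistence of `□ p` then comes from transitivity.
    ; V              = λ (w , _) p → does (em {BoxAtom p w})
    ; persistent     = λ uRv Vu → Equivalence.from (does-true⇔ em) λ w′ vRw′ →
        Equivalence.to (does-true⇔ em) Vu w′ (transitive (Unfold-forth R reflexive uRv) vRw′)
    }

  unfoldedModel-isBoxMorphism : IsBoxMorphism unfoldedModel M proj₁
  unfoldedModel-isBoxMorphism = record
    { forth = Unfold-forth R reflexive
    -- Incrementing the counter makes every `R`-step proper, even a loop from a world to itself.
    ; back  = λ {(_ , n)} {w} uRw → (w , ℕ.suc n) , inj₂ (n<1+n n , uRw) , refl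
    ; atoms = does-true⇔ em
    }

theorem4p28 : ∀ {a ℓ} → ExcludedMiddle ℓ → (P : Set a) (φ : Formula P) →
    ValidInqI ℓ φ ⇔ ValidS4MT₀ ℓ (φ ^□)
theorem4p28 em P φ = mk⇔
  (λ valid M S4 t →
    support⇒satisfies S4 (unfoldedModel-isBoxMorphism em M S4) φ
      -- Layer `0` gives each world of `t` a preimage; any fixed counter would serve.
      ((λ {w} w∈t → (w , 0) , w∈t , refl) , λ { (_ , w∈t , refl) → w∈t })
      (valid (unfoldedModel em M S4) (t ∘ proj₁)))
  (λ valid N t →
    satisfies⇒support (toModal-isS4 N) (toModal-isBoxMorphism N) φ (image-id t)
      (valid (toModal N) (toModal-isS4 N) t))
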